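{- For a positive integer $n$ let $\Delta^{(odd)}_3([0,n))$ denote the number of odd evil integers in $[0,n)$ divisible by $3$ minus the number of odd odious integers in $[0,n)$ divisible by $3$. Then $$\lim_{n\to\infty}\frac{\ln \Delta^{(odd)}_3([0,n))}{\ln n}=\frac{\ln 3}{\ln 4}.$$
   Context: A nonnegative integer is called evil if its binary expansion contains an even number of 1's, and odious if it contains an odd number of 1's. $[0,n)$ denotes the set of integers $x$ with $0\le x<n$. -}

module Defs where

open import Data.Digit using (toDigits; 1b)
import Data.Fin.Properties as Fin
open import Data.Integer.Base as ℤ using (ℤ; +_; 0ℤ; 1ℤ)
open import Data.List.Base using (length; filter; upTo)
open import Data.Nat.Base as ℕ using (ℕ; zero; suc)
open import Data.Nat.Divisibility using (_∣_; _∣?_)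
import Data.Nat.Properties as ℕ
import Data.Nat.Tactic.RingSolver as ℕ-Ring
import Data.Integer.Properties as ℤ
open import Data.Product.Base using (Σ; ∃; _×_; _,_; proj₁; proj₂)
open import Data.Rational.Base
open import Data.Rational.Properties
open import Data.Rational.Solver using (module +-*-Solver)
import Data.Rational.Unnormalised.Base as ℚᵘ
import Data.Rational.Unnormalised.Properties as ℚᵘ
open import Data.Sum.Base using (inj₁; inj₂)
open import Relation.Binary.PropositionalEquality
open import Relation.Nullary using (¬_; yes; no; contradiction; ¬?; _×-dec_)
open import Relation.Unary using (Decidable)

------------------------------------------------------------------------
-- Evil and odious numbers

ones : ℕ → ℕ
ones n = length (filter (Fin._≟ 1b) (proj₁ (toDigits 2 n)))

Even Odd Evil Odious : ℕ → Set
Even n   = 2 ∣ n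
Odd n    = ¬ Even n
Evil n   = Even (ones n)
Odious n = Odd (ones n)

odd? : Decidable Odd
odd? n = ¬? (2 ∣? n)

evil? : Decidable Evil
evil? n = 2 ∣? ones n

odious? : Decidable Odious
odious? n = odd? (ones n)

-- The number of elements of [0,n) satisfying P.
count : ∀ {P : ℕ → Set} → Decidable P → ℕ → ℕ
count P? n = length (filter P? (upTo n))

Δ₃ᵒᵈᵈ : ℕ → ℤ
Δ₃ᵒᵈᵈ n = + count (λ k → odd? k ×-dec evil? k ×-dec (3 ∣? k)) n
    ℤ.- + count (λ k → odd? k ×-dec odious? k ×-dec (3 ∣? k)) n

------------------------------------------------------------------------
-- Rational arithmetic

½ε+½ε≡ε : ∀ ε → ½ * ε + ½ * ε ≡ ε
½ε+½ε≡ε ε = trans (sym (*-distribʳ-+ ε ½ ½)) (*-identityˡ ε)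

0<p*q : ∀ {p q} → 0ℚ < p → 0ℚ < q → 0ℚ < p * q
0<p*q {p} {q} 0<p 0<q = positive⁻¹ (p * q) {{pos*pos⇒pos p {{positive 0<p}} q {{positive 0<q}}}}

0<½ε : ∀ {ε} → 0ℚ < ε → 0ℚ < ½ * ε
0<½ε = 0<p*q (positive⁻¹ ½)

*-mono-≤-nonNeg : ∀ {p q r s} → 0ℚ ≤ p → 0ℚ ≤ s → p ≤ q → r ≤ s → p * r ≤ q * s
*-mono-≤-nonNeg {p} {q} {r} {s} 0≤p 0≤s p≤q r≤s = ≤-trans
  (*-monoˡ-≤-nonNeg p {{nonNegative 0≤p}} r≤s)
  (*-monoʳ-≤-nonNeg s {{nonNegative 0≤s}} p≤q)

p≤∣p∣ : ∀ p → p ≤ ∣ p ∣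
p≤∣p∣ p with ≤-total 0ℚ p
... | inj₁ 0≤p = ≤-reflexive (sym (0≤p⇒∣p∣≡p 0≤p))
... | inj₂ p≤0 = ≤-trans p≤0 (0≤∣p∣ p)

∣p-q∣≡∣q-p∣ : ∀ p q → ∣ p - q ∣ ≡ ∣ q - p ∣
∣p-q∣≡∣q-p∣ p q = trans (sym (∣-p∣≡∣p∣ (p - q)))
  (cong ∣_∣ (solve 2 (λ p q → :- (p :- q) := q :- p) refl p q))
  where open +-*-Solver

∣p∣≤∣p-q∣+∣q∣ : ∀ p q → ∣ p ∣ ≤ ∣ p - q ∣ + ∣ q ∣
∣p∣≤∣p-q∣+∣q∣ p q = subst (λ r → ∣ r ∣ ≤ ∣ p - q ∣ + ∣ q ∣)
  (solve 2 (λ p q → (p :- q) :+ q := p) refl p q) (∣p+q∣≤∣p∣+∣q∣ (p - q) q)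
  where open +-*-Solver

p≤r+q⇒p-q≤r : ∀ {p q r} → p ≤ r + q → p - q ≤ r
p≤r+q⇒p-q≤r {p} {q} {r} h = subst (p - q ≤_)
  (solve 2 (λ r q → (r :+ q) :- q := r) refl r q) (+-monoˡ-≤ (- q) h)
  where open +-*-Solver

∣p-q∣≤r : ∀ {p q r} → p ≤ r + q → q ≤ r + p → ∣ p - q ∣ ≤ r
∣p-q∣≤r {p} {q} {r} p≤ q≤ with ∣p∣≡p∨∣p∣≡-p (p - q)
... | inj₁ e = subst (_≤ r) (sym e) (p≤r+q⇒p-q≤r p≤)
... | inj₂ e = subst (_≤ r)
  (sym (trans e (solve 2 (λ p q → :- (p :- q) := q :- p) refl p q))) (p≤r+q⇒p-q≤r q≤)
  where open +-*-Solver

∣∣p∣-∣q∣∣≤∣p-q∣ : ∀ p q → ∣ ∣ p ∣ - ∣ q ∣ ∣ ≤ ∣ p - q ∣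
∣∣p∣-∣q∣∣≤∣p-q∣ p q = ∣p-q∣≤r (∣p∣≤∣p-q∣+∣q∣ p q)
  (subst (λ d → ∣ q ∣ ≤ d + ∣ p ∣) (∣p-q∣≡∣q-p∣ q p) (∣p∣≤∣p-q∣+∣q∣ q p))

recip : ℚ → ℚ
recip p with p ≟ 0ℚ
... | yes _  = 0ℚ
... | no p≢0 = (1/ p) {{≢-nonZero p≢0}}

p*recip[p]≡1 : ∀ p → p ≢ 0ℚ → p * recip p ≡ 1ℚ
p*recip[p]≡1 p p≢0 with p ≟ 0ℚ
... | yes p≡0 = contradiction p≡0 p≢0
... | no  p≢0 = *-inverseʳ p {{≢-nonZero p≢0}}

0<recip : ∀ {p} → 0ℚ < p → 0ℚ < recip p
0<recip {p} 0<p with p ≟ 0ℚ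
... | yes p≡0 = contradiction (sym p≡0) (<⇒≢ 0<p)
... | no  p≢0 = positive⁻¹ _ {{1/pos⇒pos p {{positive 0<p}}}}

------------------------------------------------------------------------
-- Real numbers as Cauchy sequences of rationals

IsCauchy : (ℕ → ℚ) → Set
IsCauchy x = ∀ ε → 0ℚ < ε →
  ∃ λ N → ∀ m n → N ℕ.≤ m → N ℕ.≤ n → ∣ x m - x n ∣ < ε

record ℝ : Set where
  constructor mkℝ
  field
    seq    : ℕ → ℚ
    cauchy : IsCauchy seq

open ℝ public

infix 4 _<ᴿ_ _#0
infixl 6 _+ᴿ_ _-ᴿ_
infixl 7 _*ᴿ_ _/ᴿ_[_]
infix 8 -ᴿ_

_<ᴿ_ : ℝ → ℝ → Set
x <ᴿ y = ∃ λ ε → 0ℚ < ε × ∃ λ N → ∀ n → N ℕ.≤ n → seq x n + ε ≤ seq y n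

-- Apartness from zero.
_#0 : ℝ → Set
x #0 = ∃ λ ε → 0ℚ < ε × ∃ λ N → ∀ n → N ℕ.≤ n → ε ≤ ∣ seq x n ∣

fromℚ : ℚ → ℝ
fromℚ p = mkℝ (λ _ → p) λ ε 0<ε → 0 , λ _ _ _ _ →
  subst (λ z → ∣ z ∣ < ε) (sym (+-inverseʳ p)) 0<ε

_+ᴿ_ : ℝ → ℝ → ℝ
x +ᴿ y = mkℝ (λ n → seq x n + seq y n) λ ε 0<ε →
  let (N , hx) = cauchy x (½ * ε) (0<½ε 0<ε)
      (M , hy) = cauchy y (½ * ε) (0<½ε 0<ε)
  in N ℕ.⊔ M , λ m n N≤m N≤n →
    subst₂ _<_
      refl (½ε+½ε≡ε ε)
      (≤-<-trans
        (subst (λ z → ∣ z ∣ ≤ ∣ seq x m - seq x n ∣ + ∣ seq y m - seq y n ∣)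
          (solve 4 (λ a b c d → (a :- b) :+ (c :- d) := (a :+ c) :- (b :+ d)) refl
            (seq x m) (seq x n) (seq y m) (seq y n))
          (∣p+q∣≤∣p∣+∣q∣ (seq x m - seq x n) (seq y m - seq y n)))
        (+-mono-<
          (hx m n (ℕ.m⊔n≤o⇒m≤o N M N≤m) (ℕ.m⊔n≤o⇒m≤o N M N≤n))
          (hy m n (ℕ.m⊔n≤o⇒n≤o N M N≤m) (ℕ.m⊔n≤o⇒n≤o N M N≤n))))
  where open +-*-Solver

-ᴿ_ : ℝ → ℝ
-ᴿ x = mkℝ (λ n → - seq x n) λ ε 0<ε →
  let (N , h) = cauchy x ε 0<ε
  in N , λ m n N≤m N≤n → subst (_< ε)
    (trans (∣p-q∣≡∣q-p∣ (seq x m) (seq x n))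
      (cong ∣_∣ (solve 2 (λ a b → b :- a := (:- a) :- (:- b)) refl (seq x m) (seq x n))))
    (h m n N≤m N≤n)
  where open +-*-Solver

_-ᴿ_ : ℝ → ℝ → ℝ
x -ᴿ y = x +ᴿ (-ᴿ y)

∣_∣ᴿ : ℝ → ℝ
∣ x ∣ᴿ = mkℝ (λ n → ∣ seq x n ∣) λ ε 0<ε →
  let (N , h) = cauchy x ε 0<ε
  in N , λ m n N≤m N≤n →
    ≤-<-trans (∣∣p∣-∣q∣∣≤∣p-q∣ (seq x m) (seq x n)) (h m n N≤m N≤n)

eventually-bounded : ∀ x → ∃ λ B → 0ℚ < B × ∃ λ N → ∀ n → N ℕ.≤ n → ∣ seq x n ∣ ≤ B
eventually-bounded x =
  let (N , h) = cauchy x 1ℚ (positive⁻¹ 1ℚ)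
  in 1ℚ + ∣ seq x N ∣
   , +-mono-<-≤ (positive⁻¹ 1ℚ) (0≤∣p∣ (seq x N))
   , N
   , λ n N≤n → ≤-trans (∣p∣≤∣p-q∣+∣q∣ (seq x n) (seq x N))
       (+-monoˡ-≤ ∣ seq x N ∣ (<⇒≤ (h n N N≤n ℕ.≤-refl)))

_*ᴿ_ : ℝ → ℝ → ℝ
x *ᴿ y = mkℝ (λ n → seq x n * seq y n) *-cauchy
  where
  open +-*-Solver
  *-cauchy : IsCauchy (λ n → seq x n * seq y n)
  *-cauchy ε 0<ε =
    let (B , 0<B , K , bx) = eventually-bounded x
        (C , 0<C , L , by) = eventually-bounded y
        δ = ½ * ε
        0<δ = 0<½ε 0<ε
        (N , hx) = cauchy x (δ * recip C) (0<p*q 0<δ (0<recip 0<C))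
        (M , hy) = cauchy y (δ * recip B) (0<p*q 0<δ (0<recip 0<B))
        P = (K ℕ.⊔ L) ℕ.⊔ (N ℕ.⊔ M)
        K≤ : ∀ {m} → P ℕ.≤ m → K ℕ.≤ m
        K≤ h = ℕ.m⊔n≤o⇒m≤o K L (ℕ.m⊔n≤o⇒m≤o (K ℕ.⊔ L) (N ℕ.⊔ M) h)
        L≤ : ∀ {m} → P ℕ.≤ m → L ℕ.≤ m
        L≤ h = ℕ.m⊔n≤o⇒n≤o K L (ℕ.m⊔n≤o⇒m≤o (K ℕ.⊔ L) (N ℕ.⊔ M) h)
        N≤ : ∀ {m} → P ℕ.≤ m → N ℕ.≤ m
        N≤ h = ℕ.m⊔n≤o⇒m≤o N M (ℕ.m⊔n≤o⇒n≤o (K ℕ.⊔ L) (N ℕ.⊔ M) h)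
        M≤ : ∀ {m} → P ℕ.≤ m → M ℕ.≤ m
        M≤ h = ℕ.m⊔n≤o⇒n≤o N M (ℕ.m⊔n≤o⇒n≤o (K ℕ.⊔ L) (N ℕ.⊔ M) h)
        bound : ∀ {D p q} → 0ℚ < D → ∣ p ∣ ≤ D → ∣ q ∣ < δ * recip D → ∣ p * q ∣ < δ
        bound {D} {p} {q} 0<D p≤D q< = subst₂ _<_
          (sym (∣p*q∣≡∣p∣*∣q∣ p q))
          (trans (solve 3 (λ a b c → a :* (b :* c) := b :* (a :* c)) refl D δ (recip D))
            (trans (cong (δ *_) (p*recip[p]≡1 D (λ e → <⇒≢ 0<D (sym e)))) (*-identityʳ δ)))
          (≤-<-trans (*-monoʳ-≤-nonNeg ∣ q ∣ {{∣-∣-nonNeg q}} p≤D)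
            (*-monoʳ-<-pos D {{positive 0<D}} q<))
    in P , λ m n P≤m P≤n →
      let a = seq x m ; b = seq y m ; c = seq x n ; d = seq y n in
      subst₂ _<_ (cong ∣_∣ (solve 4
          (λ a b c d → a :* (b :- d) :+ d :* (a :- c) := a :* b :- c :* d) refl a b c d))
        (½ε+½ε≡ε ε)
        (≤-<-trans (∣p+q∣≤∣p∣+∣q∣ (a * (b - d)) (d * (a - c)))
          (+-mono-<
            (bound 0<B (bx m (K≤ P≤m)) (hy m n (M≤ P≤m) (M≤ P≤n)))
            (bound 0<C (by n (L≤ P≤n)) (hx m n (N≤ P≤m) (N≤ P≤n)))))

∣recip-recip∣< : ∀ {η ε p q} → 0ℚ < η → 0ℚ < ε → η ≤ ∣ p ∣ → η ≤ ∣ q ∣ →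
                 ∣ p - q ∣ < η * η * ε → ∣ recip p - recip q ∣ < ε
∣recip-recip∣< {η} {ε} {p} {q} 0<η 0<ε η≤p η≤q h =
  *-cancelˡ-<-nonNeg (∣ p ∣ * ∣ q ∣) {{nonNegative 0≤∣p∣∣q∣}}
    (≤-<-trans (≤-reflexive eq)
      (<-≤-trans h (*-monoʳ-≤-nonNeg ε {{nonNegative (<⇒≤ 0<ε)}}
        (*-mono-≤-nonNeg (<⇒≤ 0<η) (0≤∣p∣ q) η≤p η≤q))))
  where
  open +-*-Solver
  0≤∣p∣∣q∣ : 0ℚ ≤ ∣ p ∣ * ∣ q ∣
  0≤∣p∣∣q∣ = subst (0ℚ ≤_) (∣p*q∣≡∣p∣*∣q∣ p q) (0≤∣p∣ (p * q))
  ≢0 : ∀ {r} → η ≤ ∣ r ∣ → r ≢ 0ℚ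
  ≢0 η≤r refl = <-irrefl refl (<-≤-trans 0<η η≤r)
  ring : ∀ p q s t → (p * q) * (s - t) ≡ q * (p * s) - p * (q * t)
  ring = solve 4 (λ p q s t → (p :* q) :* (s :- t) := q :* (p :* s) :- p :* (q :* t)) refl
  eq : (∣ p ∣ * ∣ q ∣) * ∣ recip p - recip q ∣ ≡ ∣ p - q ∣
  eq = begin
    (∣ p ∣ * ∣ q ∣) * ∣ recip p - recip q ∣
      ≡⟨ cong (_* ∣ recip p - recip q ∣) (∣p*q∣≡∣p∣*∣q∣ p q) ⟨
    ∣ p * q ∣ * ∣ recip p - recip q ∣
      ≡⟨ ∣p*q∣≡∣p∣*∣q∣ (p * q) (recip p - recip q) ⟨
    ∣ (p * q) * (recip p - recip q) ∣
      ≡⟨ cong ∣_∣ (ring p q (recip p) (recip q)) ⟩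
    ∣ q * (p * recip p) - p * (q * recip q) ∣
      ≡⟨ cong₂ (λ s t → ∣ q * s - p * t ∣) (p*recip[p]≡1 p (≢0 η≤p)) (p*recip[p]≡1 q (≢0 η≤q)) ⟩
    ∣ q * 1ℚ - p * 1ℚ ∣
      ≡⟨ cong₂ (λ s t → ∣ s - t ∣) (*-identityʳ q) (*-identityʳ p) ⟩
    ∣ q - p ∣
      ≡⟨ ∣p-q∣≡∣q-p∣ q p ⟩
    ∣ p - q ∣ ∎
    where open ≡-Reasoning

inverse : (x : ℝ) → x #0 → ℝ
inverse x (η , 0<η , K , apart) = mkℝ (λ n → recip (seq x n)) λ ε 0<ε →
  let (N , h) = cauchy x (η * η * ε) (0<p*q (0<p*q 0<η 0<η) 0<ε)
  in K ℕ.⊔ N , λ m n ≤m ≤n → ∣recip-recip∣< 0<η 0<ε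
       (apart m (ℕ.m⊔n≤o⇒m≤o K N ≤m)) (apart n (ℕ.m⊔n≤o⇒m≤o K N ≤n))
       (h m n (ℕ.m⊔n≤o⇒n≤o K N ≤m) (ℕ.m⊔n≤o⇒n≤o K N ≤n))

_/ᴿ_[_] : ℝ → (y : ℝ) → y #0 → ℝ
x /ᴿ y [ y#0 ] = x *ᴿ inverse y y#0

-- lim a(n) = L as n → ∞, for a sequence whose n-th term is only defined
-- when Dom n holds; the terms are required to be defined from some point on.
HasLimit : (Dom : ℕ → Set) → (∀ n → Dom n → ℝ) → ℝ → Set
HasLimit Dom a L = ∀ ε → 0ℚ < ε → ∃ λ N → ∀ n → N ℕ.≤ n →
  Σ (Dom n) λ d → ∣ a n d -ᴿ L ∣ᴿ <ᴿ fromℚ ε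

------------------------------------------------------------------------
-- The natural logarithm of a positive integer, ln z = ∫₁ᶻ dt/t

/-mono-≤ : ∀ {a b c d} → a ℕ.* suc d ℕ.≤ c ℕ.* suc b → + a / suc b ≤ + c / suc d
/-mono-≤ {a} {b} {c} {d} h = toℚᵘ-cancel-≤
  (ℚᵘ.≤-respˡ-≃ (ℚᵘ.≃-sym (toℚᵘ-fromℚᵘ (ℚᵘ.mkℚᵘ (+ a) b)))
    (ℚᵘ.≤-respʳ-≃ (ℚᵘ.≃-sym (toℚᵘ-fromℚᵘ (ℚᵘ.mkℚᵘ (+ c) d)))
      (ℚᵘ.*≤* (subst₂ ℤ._≤_ (ℤ.pos-* a (suc d)) (ℤ.pos-* c (suc b)) (ℤ.+≤+ h)))))

/-+-suc : ∀ l d → + suc l / suc d ≡ + l / suc d + + 1 / suc d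
/-+-suc l d = toℚᵘ-injective (ℚᵘ.≃-trans (toℚᵘ-fromℚᵘ (ℚᵘ.mkℚᵘ (+ suc l) d))
  (ℚᵘ.≃-trans (ℚᵘ.*≡* eq)
    (ℚᵘ.≃-trans
      (ℚᵘ.≃-sym (ℚᵘ.+-cong (toℚᵘ-fromℚᵘ (ℚᵘ.mkℚᵘ (+ l) d)) (toℚᵘ-fromℚᵘ (ℚᵘ.mkℚᵘ (+ 1) d))))
      (ℚᵘ.≃-sym (toℚᵘ-homo-+ (+ l / suc d) (+ 1 / suc d))))))
  where
  D = + suc d
  eq : + suc l ℤ.* (+ (suc d ℕ.* suc d)) ≡ (+ l ℤ.* D ℤ.+ + 1 ℤ.* D) ℤ.* D
  eq = begin
    + suc l ℤ.* (+ (suc d ℕ.* suc d))      ≡⟨ cong (+ suc l ℤ.*_) (ℤ.pos-* (suc d) (suc d)) ⟩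
    + suc l ℤ.* (D ℤ.* D)                  ≡⟨ ℤ.*-assoc (+ suc l) D D ⟨
    (+ suc l ℤ.* D) ℤ.* D                  ≡⟨ cong (λ z → (+ z ℤ.* D) ℤ.* D) (ℕ.+-comm l 1) ⟨
    (+ (l ℕ.+ 1) ℤ.* D) ℤ.* D              ≡⟨ cong (ℤ._* D) (ℤ.*-distribʳ-+ D (+ l) (+ 1)) ⟩
    (+ l ℤ.* D ℤ.+ + 1 ℤ.* D) ℤ.* D        ∎
    where open ≡-Reasoning

0≤1/suc : ∀ d → 0ℚ ≤ + 1 / suc d
0≤1/suc d = nonNegative⁻¹ _ {{normalize-nonNeg 1 (suc d)}}

-- harmonic a k = 1/(a+1) + 1/(a+2) + ⋯ + 1/(a+k)
harmonic : ℕ → ℕ → ℚ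
harmonic a zero    = 0ℚ
harmonic a (suc k) = harmonic a k + + 1 / suc (a ℕ.+ k)

-- The right-endpoint Riemann sum of 1/t over [1,n] with mesh 1/M, M = m+1:
--   Σ_{i < (n-1)M} (1/M) · 1/(1 + (i+1)/M)  =  Σ_{i < (n-1)M} 1/(M+i+1).
riemannSum : ℕ → ℕ → ℚ
riemannSum n m = harmonic (suc m) ((n ℕ.∸ 1) ℕ.* suc m)

harmonic-+ : ∀ a k l → harmonic a (k ℕ.+ l) ≡ harmonic a k + harmonic (a ℕ.+ k) l
harmonic-+ a k zero = trans (cong (harmonic a) (ℕ.+-identityʳ k)) (sym (+-identityʳ (harmonic a k)))
harmonic-+ a k (suc l) = begin
  harmonic a (k ℕ.+ suc l)
    ≡⟨ cong (harmonic a) (ℕ.+-suc k l) ⟩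
  harmonic a (k ℕ.+ l) + + 1 / suc (a ℕ.+ (k ℕ.+ l))
    ≡⟨ cong₂ (λ p d → p + + 1 / suc d) (harmonic-+ a k l) (sym (ℕ.+-assoc a k l)) ⟩
  (harmonic a k + harmonic (a ℕ.+ k) l) + + 1 / suc (a ℕ.+ k ℕ.+ l)
    ≡⟨ +-assoc (harmonic a k) (harmonic (a ℕ.+ k) l) _ ⟩
  harmonic a k + harmonic (a ℕ.+ k) (suc l) ∎
  where open ≡-Reasoning

0≤harmonic : ∀ a k → 0ℚ ≤ harmonic a k
0≤harmonic a zero    = ≤-refl
0≤harmonic a (suc k) = +-mono-≤ (0≤harmonic a k) (0≤1/suc (a ℕ.+ k))

harmonic-≤-+ : ∀ a k l → harmonic a k ≤ harmonic a (k ℕ.+ l)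
harmonic-≤-+ a k l = subst₂ _≤_ (+-identityʳ (harmonic a k)) (sym (harmonic-+ a k l))
  (+-monoʳ-≤ (harmonic a k) (0≤harmonic (a ℕ.+ k) l))

harmonic-lower : ∀ a l d → a ℕ.+ l ℕ.≤ suc d → + l / suc d ≤ harmonic a l
harmonic-lower a zero    d h = ≤-reflexive (0/n≡0 (suc d))
harmonic-lower a (suc l) d h = subst (_≤ harmonic a (suc l)) (sym (/-+-suc l d))
  (+-mono-≤ (harmonic-lower a l d (ℕ.≤-trans (ℕ.+-monoʳ-≤ a (ℕ.n≤1+n l)) h))
    (/-mono-≤ {1} {d} {1} {a ℕ.+ l} (ℕ.*-monoʳ-≤ 1 (subst (ℕ._≤ suc d) (ℕ.+-suc a l) h))))

harmonic-upper : ∀ a l → harmonic (suc a) l ≤ + l / suc a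
harmonic-upper a zero    = ≤-reflexive (sym (0/n≡0 (suc a)))
harmonic-upper a (suc l) = subst (harmonic (suc a) (suc l) ≤_) (sym (/-+-suc l a))
  (+-mono-≤ (harmonic-upper a l)
    (/-mono-≤ {1} {suc a ℕ.+ l} {1} {a}
      (ℕ.*-monoʳ-≤ 1 (ℕ.≤-trans (ℕ.m≤m+n (suc a) l) (ℕ.n≤1+n _)))))

harmonic-block : ∀ a k K → harmonic (a ℕ.* K) (suc k ℕ.* K) ≡
                 harmonic (a ℕ.* K) (k ℕ.* K) + harmonic ((a ℕ.+ k) ℕ.* K) K
harmonic-block a k K = begin
  harmonic (a ℕ.* K) (K ℕ.+ k ℕ.* K)
    ≡⟨ cong (harmonic (a ℕ.* K)) (ℕ.+-comm K (k ℕ.* K)) ⟩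
  harmonic (a ℕ.* K) (k ℕ.* K ℕ.+ K)
    ≡⟨ harmonic-+ (a ℕ.* K) (k ℕ.* K) K ⟩
  harmonic (a ℕ.* K) (k ℕ.* K) + harmonic (a ℕ.* K ℕ.+ k ℕ.* K) K
    ≡⟨ cong (λ b → harmonic (a ℕ.* K) (k ℕ.* K) + harmonic b K) (ℕ.*-distribʳ-+ K a k) ⟨
  harmonic (a ℕ.* K) (k ℕ.* K) + harmonic ((a ℕ.+ k) ℕ.* K) K ∎
  where open ≡-Reasoning

refine-lower : ∀ a k K → harmonic a k ≤ harmonic (a ℕ.* suc K) (k ℕ.* suc K)
refine-lower a zero    K = ≤-refl
refine-lower a (suc k) K = subst (harmonic a (suc k) ≤_) (sym (harmonic-block a k (suc K)))
  (+-mono-≤ (refine-lower a k K) (≤-trans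
    (/-mono-≤ {1} {b} {suc K} {K ℕ.+ b ℕ.* suc K}
      (ℕ.≤-reflexive (trans (ℕ.*-identityˡ _) (ℕ.*-comm (suc b) (suc K)))))
    (harmonic-lower (b ℕ.* suc K) (suc K) _ (ℕ.≤-reflexive (ℕ.+-comm (b ℕ.* suc K) (suc K))))))
  where b = a ℕ.+ k

refine-upper : ∀ a k K → harmonic (suc a ℕ.* suc K) (k ℕ.* suc K) ≤ harmonic a k
refine-upper a zero    K = ≤-refl
refine-upper a (suc k) K = subst (_≤ harmonic a (suc k)) (sym (harmonic-block (suc a) k (suc K)))
  (+-mono-≤ (refine-upper a k K) (≤-trans
    (harmonic-upper (K ℕ.+ b ℕ.* suc K) (suc K))
    (/-mono-≤ {suc K} {K ℕ.+ b ℕ.* suc K} {1} {b}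
      (ℕ.≤-reflexive (trans (ℕ.*-comm (suc K) (suc b)) (sym (ℕ.*-identityˡ _)))))))
  where b = a ℕ.+ k

harmonic-shift : ∀ a k → harmonic a k ≤ + 1 / suc a + harmonic (suc a) k
harmonic-shift a k = ≤-trans (harmonic-≤-+ a k 1) (≤-reflexive (begin
  harmonic a (k ℕ.+ 1)                        ≡⟨ cong (harmonic a) (ℕ.+-comm k 1) ⟩
  harmonic a (1 ℕ.+ k)                        ≡⟨ harmonic-+ a 1 k ⟩
  harmonic a 1 + harmonic (a ℕ.+ 1) k         ≡⟨ cong₂ (λ b c → 0ℚ + + 1 / suc b + harmonic c k) (ℕ.+-identityʳ a) (ℕ.+-comm a 1) ⟩
  0ℚ + + 1 / suc a + harmonic (suc a) k       ≡⟨ cong (_+ harmonic (suc a) k) (+-identityˡ (+ 1 / suc a)) ⟩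
  + 1 / suc a + harmonic (suc a) k            ∎))
  where open ≡-Reasoning

riemannSum-≤ : ∀ n m m′ → riemannSum n m ≤ + 1 / suc m′ + riemannSum n m′
riemannSum-≤ n m m′ = ≤-trans (refine-lower M (c ℕ.* M) m′) (≤-trans
  (≤-reflexive (cong₂ harmonic (ℕ.*-comm M M′) (swap c M M′)))
  (≤-trans (refine-upper m′ (c ℕ.* M′) m) (harmonic-shift m′ (c ℕ.* M′))))
  where
  c = n ℕ.∸ 1
  M = suc m
  M′ = suc m′
  swap : ∀ a b c → a ℕ.* b ℕ.* c ≡ a ℕ.* c ℕ.* b
  swap a b c = trans (ℕ.*-assoc a b c) (trans (cong (a ℕ.*_) (ℕ.*-comm b c)) (sym (ℕ.*-assoc a c b)))

1/[1+↧ε]<ε : ∀ ε → 0ℚ < ε → + 1 / suc (↧ₙ ε) < ε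
1/[1+↧ε]<ε ε 0<ε with positive {ε} 0<ε
1/[1+↧ε]<ε ε@(mkℚ (+ suc p) q _) 0<ε | _ = toℚᵘ-cancel-<
  (ℚᵘ.<-respˡ-≃ (ℚᵘ.≃-sym (toℚᵘ-fromℚᵘ (ℚᵘ.mkℚᵘ (+ 1) (suc q))))
    (ℚᵘ.*<* (subst₂ ℤ._<_ (ℤ.pos-* 1 (suc q)) (ℤ.pos-* (suc p) (suc (suc q)))
      (ℤ.+<+ (ℕ.<-≤-trans (ℕ.≤-reflexive (cong suc (ℕ.*-identityˡ (suc q))))
        (ℕ.m≤m+n (suc (suc q)) (p ℕ.* suc (suc q))))))))

riemannSum-cauchy : ∀ n → IsCauchy (riemannSum n)
riemannSum-cauchy n ε 0<ε = N , λ m m′ N≤m N≤m′ →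
  ≤-<-trans (∣p-q∣≤r (close m m′ N≤m′) (close m′ m N≤m)) (1/[1+↧ε]<ε ε 0<ε)
  where
  N = ↧ₙ ε
  close : ∀ m m′ → N ℕ.≤ m′ → riemannSum n m ≤ + 1 / suc N + riemannSum n m′
  close m m′ N≤m′ = ≤-trans (riemannSum-≤ n m m′)
    (+-monoˡ-≤ (riemannSum n m′) (/-mono-≤ {1} {m′} {1} {N} (ℕ.*-monoʳ-≤ 1 (ℕ.s≤s N≤m′))))

ln : (z : ℤ) → .(0ℤ ℤ.< z) → ℝ
ln z _ = mkℝ (riemannSum ℤ.∣ z ∣) (riemannSum-cauchy ℤ.∣ z ∣)

½≤riemannSum : ∀ n m → ½ ≤ riemannSum (suc (suc n)) m
½≤riemannSum n m = ≤-trans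
  (/-mono-≤ {1} {1} {M} {m ℕ.+ M} (ℕ.≤-reflexive (double m)))
  (≤-trans (harmonic-lower M M (m ℕ.+ M) ℕ.≤-refl) (harmonic-≤-+ M M (n ℕ.* M)))
  where
  M = suc m
  double : ∀ m → 1 ℕ.* (suc m ℕ.+ suc m) ≡ suc m ℕ.* 2
  double = ℕ-Ring.solve-∀

1<z⇒0<z : ∀ {z} → 1ℤ ℤ.< z → 0ℤ ℤ.< z
1<z⇒0<z = ℤ.<-trans (ℤ.+<+ ℕ.z<s)

ln#0 : ∀ {z} (1<z : 1ℤ ℤ.< z) → ln z (1<z⇒0<z 1<z) #0
ln#0 {+ suc (suc n)} _ = ½ , positive⁻¹ ½ , 0 , λ m _ →
  ≤-trans (½≤riemannSum n m) (p≤∣p∣ _)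
ln#0 {+ 1} (ℤ.+<+ (ℕ.s≤s ()))
ln#0 {+ 0} (ℤ.+<+ ())

0<3 : 0ℤ ℤ.< + 3
0<3 = ℤ.+<+ ℕ.z<s

1<4 : 1ℤ ℤ.< + 4
1<4 = ℤ.+<+ (ℕ.s<s ℕ.z<s)

{-# OPTIONS --safe #-}

-- Let t(k) = 1 for evil k and t(k) = -1 for odious k. An odd multiple of 3 is 2l + 1
-- with l ≡ 1 mod 3, and t(2l + 1) = -t(l), so Δ₃ᵒᵈᵈ n = A(⌊n/2⌋) where A(q) is the sum of
-- -t(l) over l < q with l ≡ 1 mod 3. Grouping l by ⌊l/4⌋, the signs +,-,-,+ of t on a
-- block of four give A(4q) = 3A(q) + T(q), where T(q), the sum of t over [0,q), is 0 or ±1.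
-- Hence A(4q+r) differs from 3A(q) by at most 2 for r < 4, so A + 1 at most triples and
-- A - 1 at least triples when passing from q to 4q+r. Since A ≥ 2 from 5 on, Δ₃ᵒᵈᵈ n lies
-- between 3^(m-2) and 3^(m+1) when 4^m ≤ n < 4^(m+1), so the quotient of the logarithms
-- differs from ln 3 / ln 4 by O(1/m). For the Riemann sums defining ln, the functional
-- equation holds up to the mesh size, which is enough once the mesh is fine compared to 1/m.
module Submission where

open import Defs
open import Data.Nat.Base as ℕ using (ℕ; zero; suc; _^_; s≤s; z≤n)
import Data.Nat.Properties as ℕ
import Data.Nat.Tactic.RingSolver as ℕ-Ring
import Data.Integer.Base as ℤ
import Data.Integer.Properties as ℤ
open import Data.Integer.Base using (+_; 0ℤ; 1ℤ; _<_)
import Data.Rational.Base as ℚ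
import Data.Rational.Properties as ℚ
open import Data.Product.Base using (∃; _×_; _,_; proj₁; proj₂)
open import Relation.Binary.PropositionalEquality
open import Relation.Nullary using (¬_; Dec; yes; no; contradiction; _×-dec_)

module ThueMorse where

  open import Data.Digit using (Bit; Expansion; fromDigits; toDigits; 0b; 1b)
  open import Data.Fin.Base using (Fin; zero; suc; toℕ; fromℕ<)
  import Data.Fin.Properties as Fin
  open import Data.Integer.Base using (ℤ; -_; _+_; _-_; _*_; _≤_; -1ℤ)
  import Data.Integer.Tactic.RingSolver as ℤ-Ring
  open import Data.List.Base using ([]; _∷_; _++_; length; filter; upTo)
  open import Data.List.Properties using (upTo-∷ʳ; filter-++; length-++; filter-accept; filter-reject)
  open import Data.Nat.Divisibility using (_∣_; _∣?_; divides; ∣m+n∣m⇒∣n; ∣m∣n⇒∣m+n)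
  open import Data.Nat.DivMod using (_divMod_; result)
  open import Data.Nat.Induction using (<-rec)
  open import Data.Sum.Base using (_⊎_; inj₁; inj₂)
  open import Relation.Nullary.Decidable using (from-yes; from-no)
  open import Relation.Unary using (Decidable)

  -- Binary digits and the Thue-Morse sign

  popcount : Expansion 2 → ℕ
  popcount ds = length (filter (Fin._≟ 1b) ds)

  m*2≢1+n*2 : ∀ m n → m ℕ.* 2 ≢ 1 ℕ.+ n ℕ.* 2
  m*2≢1+n*2 m n eq = ℕ.even≢odd m n
    (trans (ℕ.*-comm 2 m) (trans eq (cong suc (ℕ.*-comm n 2))))

  -- Two expansions of one number differ only in zeros at the high end, which contribute no ones. So
  -- the output of `toDigits` can be traded for any expansion at hand without unfolding the
  -- algorithm.
  popcount-cong : ∀ ds es → fromDigits ds ≡ fromDigits es → popcount ds ≡ popcount es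
  popcount-cong [] [] _ = refl
  popcount-cong [] (zero ∷ es) eq =
    popcount-cong [] es (ℕ.*-cancelʳ-≡ 0 (fromDigits es) 2 eq)
  popcount-cong (zero ∷ ds) [] eq =
    popcount-cong ds [] (ℕ.*-cancelʳ-≡ (fromDigits ds) 0 2 eq)
  popcount-cong (zero ∷ ds) (zero ∷ es) eq =
    popcount-cong ds es (ℕ.*-cancelʳ-≡ (fromDigits ds) (fromDigits es) 2 eq)
  popcount-cong (zero ∷ ds) (suc zero ∷ es) eq =
    contradiction eq (m*2≢1+n*2 (fromDigits ds) (fromDigits es))
  popcount-cong (suc zero ∷ ds) (zero ∷ es) eq =
    contradiction (sym eq) (m*2≢1+n*2 (fromDigits es) (fromDigits ds))
  popcount-cong (suc zero ∷ ds) (suc zero ∷ es) eq = cong suc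
    (popcount-cong ds es (ℕ.*-cancelʳ-≡ (fromDigits ds) (fromDigits es) 2 (ℕ.suc-injective eq)))

  ones-∷ : ∀ (d : Bit) n → ones (toℕ d ℕ.+ n ℕ.* 2) ≡ popcount (d ∷ proj₁ (toDigits 2 n))
  ones-∷ d n = popcount-cong (proj₁ (toDigits 2 (toℕ d ℕ.+ n ℕ.* 2))) (d ∷ proj₁ (toDigits 2 n))
    (trans (proj₂ (toDigits 2 (toℕ d ℕ.+ n ℕ.* 2)))
      (cong (λ k → toℕ d ℕ.+ k ℕ.* 2) (sym (proj₂ (toDigits 2 n)))))

  sign : ℕ → ℤ
  sign zero    = 1ℤ
  sign (suc n) = - sign n

  sign-even : ∀ {n} → 2 ∣ n → sign n ≡ 1ℤ
  sign-even (divides k refl) = go k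
    where
    go : ∀ k → sign (k ℕ.* 2) ≡ 1ℤ
    go zero    = refl
    go (suc k) = trans (ℤ.neg-involutive _) (go k)

  sign-odd : ∀ {n} → ¬ 2 ∣ n → sign n ≡ -1ℤ
  sign-odd {n} ¬2∣n with n divMod 2
  ... | result k zero       refl = contradiction (divides k refl) ¬2∣n
  ... | result k (suc zero) refl = cong -_ (sign-even (divides k refl))

  -- The Thue–Morse sequence.
  tm : ℕ → ℤ
  tm n = sign (ones n)

  tm-even : ∀ n → tm (n ℕ.* 2) ≡ tm n
  tm-even n = cong sign (ones-∷ 0b n)

  tm-odd : ∀ n → tm (1 ℕ.+ n ℕ.* 2) ≡ - tm n
  tm-odd n = cong sign (ones-∷ 1b n)

  tm±1 : ∀ n → tm n ≡ 1ℤ ⊎ tm n ≡ -1ℤ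
  tm±1 n with 2 ∣? ones n
  ... | yes p = inj₁ (sign-even p)
  ... | no ¬p = inj₂ (sign-odd ¬p)

  module _ (n : ℕ) where

    private
      n*4≡n*2*2 : n ℕ.* 4 ≡ n ℕ.* 2 ℕ.* 2
      n*4≡n*2*2 = sym (ℕ.*-assoc n 2 2)

    tm-4n : tm (n ℕ.* 4) ≡ tm n
    tm-4n = trans (cong tm n*4≡n*2*2) (trans (tm-even (n ℕ.* 2)) (tm-even n))

    tm-4n+1 : tm (1 ℕ.+ n ℕ.* 4) ≡ - tm n
    tm-4n+1 = trans (cong (λ k → tm (1 ℕ.+ k)) n*4≡n*2*2)
      (trans (tm-odd (n ℕ.* 2)) (cong -_ (tm-even n)))

    tm-4n+2 : tm (2 ℕ.+ n ℕ.* 4) ≡ - tm n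
    tm-4n+2 = trans (cong (λ k → tm (2 ℕ.+ k)) n*4≡n*2*2)
      (trans (tm-even (1 ℕ.+ n ℕ.* 2)) (tm-odd n))

    tm-4n+3 : tm (3 ℕ.+ n ℕ.* 4) ≡ tm n
    tm-4n+3 = trans (cong (λ k → tm (3 ℕ.+ k)) n*4≡n*2*2)
      (trans (tm-odd (1 ℕ.+ n ℕ.* 2)) (trans (cong -_ (tm-odd n)) (ℤ.neg-involutive (tm n))))

  -- The indicator `χ` of residue 1 modulo 3

  χ : ℕ → ℤ
  χ 0 = 0ℤ
  χ 1 = 1ℤ
  χ 2 = 0ℤ
  χ (suc (suc (suc n))) = χ n

  -- 4 ≡ 1 modulo 3. Each step of the induction moves one unit into `j` and drops a 3, on which `χ`
  -- is periodic by definition.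
  χ-4n : ∀ j n → χ (j ℕ.+ n ℕ.* 4) ≡ χ (j ℕ.+ n)
  χ-4n j zero    = refl
  χ-4n j (suc n) = begin
    χ (j ℕ.+ (4 ℕ.+ n ℕ.* 4))    ≡⟨ cong χ (swap j (n ℕ.* 4)) ⟩
    χ (suc j ℕ.+ n ℕ.* 4)        ≡⟨ χ-4n (suc j) n ⟩
    χ (suc j ℕ.+ n)              ≡⟨ cong χ (sym (ℕ.+-suc j n)) ⟩
    χ (j ℕ.+ suc n)              ∎
    where
    open ≡-Reasoning
    swap : ∀ j k → j ℕ.+ (4 ℕ.+ k) ≡ 3 ℕ.+ (suc j ℕ.+ k)
    swap j k = trans (sym (ℕ.+-assoc j 4 k)) (cong (ℕ._+ k) (ℕ.+-comm j 4))

  -- The possible shapes of three consecutive values of `χ`, as a datatype so that matching turns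
  -- the values into literals.
  data Window : ℤ → ℤ → ℤ → Set where
    w010 : Window 0ℤ 1ℤ 0ℤ
    w100 : Window 1ℤ 0ℤ 0ℤ
    w001 : Window 0ℤ 0ℤ 1ℤ

  χ-window : ∀ n → Window (χ n) (χ (1 ℕ.+ n)) (χ (2 ℕ.+ n))
  χ-window 0 = w010
  χ-window 1 = w100
  χ-window 2 = w001
  χ-window (suc (suc (suc n))) = χ-window n

  window-sum : ∀ {u v w} → Window u v w → u + v + w ≡ 1ℤ
  window-sum w010 = refl
  window-sum w100 = refl
  window-sum w001 = refl

  -- Raising l by 3 raises 2l + 1 by 6, a multiple of 3, so only l = 0, 1, 2 need checking.
  χ-divides : ∀ l → (3 ∣ 1 ℕ.+ l ℕ.* 2 × χ l ≡ 1ℤ) ⊎ (¬ 3 ∣ 1 ℕ.+ l ℕ.* 2 × χ l ≡ 0ℤ)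
  χ-divides 0 = inj₂ (from-no (3 ∣? 1) , refl)
  χ-divides 1 = inj₁ (divides 1 refl , refl)
  χ-divides 2 = inj₂ (from-no (3 ∣? 5) , refl)
  χ-divides (suc (suc (suc l))) with χ-divides l
  ... | inj₁ (3∣ , eq) = inj₁ (∣m∣n⇒∣m+n (divides 2 refl) 3∣ , eq)
  ... | inj₂ (3∤ , eq) = inj₂ ((λ 3∣ → 3∤ (∣m+n∣m⇒∣n 3∣ (divides 2 refl))) , eq)

  -- Partial sums and the base-4 recursion

  ∑ : (ℕ → ℤ) → ℕ → ℤ
  ∑ f zero    = 0ℤ
  ∑ f (suc n) = ∑ f n + f n

  Small : ℤ → Set
  Small i = -1ℤ ≤ i × i ≤ 1ℤ

  small₀ : Small 0ℤ
  small₀ = from-yes (-1ℤ ℤ.≤? 0ℤ) , from-yes (0ℤ ℤ.≤? 1ℤ)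

  small₁ : Small 1ℤ
  small₁ = from-yes (-1ℤ ℤ.≤? 1ℤ) , ℤ.≤-refl

  small₋₁ : Small -1ℤ
  small₋₁ = ℤ.≤-refl , from-yes (-1ℤ ℤ.≤? 1ℤ)

  -- The terms at 2k and 2k + 1 are opposite and cancel.
  ∑tm-even : ∀ k → ∑ tm (k ℕ.* 2) ≡ 0ℤ
  ∑tm-even zero = refl
  ∑tm-even (suc k) rewrite ∑tm-even k | tm-even k | tm-odd k =
    trans (cong (_+ - tm k) (ℤ.+-identityˡ (tm k))) (ℤ.+-inverseʳ (tm k))

  ∑tm-small : ∀ n → Small (∑ tm n)
  ∑tm-small n with n divMod 2
  ... | result k zero refl = subst Small (sym (∑tm-even k)) small₀
  ... | result k (suc zero) refl rewrite ∑tm-even k | tm-even k with tm±1 k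
  ...   | inj₁ eq rewrite eq = small₁
  ...   | inj₂ eq rewrite eq = small₋₁

  term : ℤ → ℤ → ℤ
  term u t = u * - t

  A : ℕ → ℤ
  A = ∑ (λ l → term (χ l) (tm l))

  -- With t = `tm q`, a block contributes -ut + vt + wt - ut, which is 3(-ut) + (u + v + w)t. The
  -- first part is three times the term of `A` at q; since u + v + w = 1, the second is the term t
  -- of `∑ tm`.
  A-4n : ∀ q → A (q ℕ.* 4) ≡ + 3 * A q + ∑ tm q
  A-4n zero = refl
  A-4n (suc q) = begin
    A (suc q ℕ.* 4)
      ≡⟨ cong₂ _+_ (cong₂ _+_ (cong₂ _+_ (cong₂ _+_ (A-4n q)
           (cong₂ term (χ-4n 0 q) (tm-4n q))) (cong₂ term (χ-4n 1 q) (tm-4n+1 q)))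
           -- At the index 3 + 4q, `χ` reduces by periodicity to its value at 4q, hence `χ-4n 0`
           -- again.
           (cong₂ term (χ-4n 2 q) (tm-4n+2 q))) (cong₂ term (χ-4n 0 q) (tm-4n+3 q)) ⟩
    + 3 * A q + ∑ tm q + term u t + term v (- t) + term w (- t) + term u t
      ≡⟨ ring (A q) (∑ tm q) t u v w ⟩
    + 3 * (A q + term u t) + (∑ tm q + (u + v + w) * t)
      ≡⟨ cong (λ k → + 3 * (A q + term u t) + (∑ tm q + k * t)) (window-sum (χ-window q)) ⟩
    + 3 * (A q + term u t) + (∑ tm q + 1ℤ * t)
      ≡⟨ cong (λ k → + 3 * (A q + term u t) + (∑ tm q + k)) (ℤ.*-identityˡ t) ⟩
    + 3 * A (suc q) + ∑ tm (suc q) ∎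
    where
    open ≡-Reasoning
    t = tm q
    u = χ q
    v = χ (1 ℕ.+ q)
    w = χ (2 ℕ.+ q)
    ring : ∀ a s t u v w → + 3 * a + s + u * - t + v * - - t + w * - - t + u * - t
                         ≡ + 3 * (a + u * - t) + (s + (u + v + w) * t)
    ring = ℤ-Ring.solve-∀

  -- A window has a single 1, so among the first three terms of a block only one is nonzero, and it
  -- is 1 or -1.
  window-small : ∀ {u v w t} → Window u v w → t ≡ 1ℤ ⊎ t ≡ -1ℤ →
    Small (u * - t) × Small (u * - t + v * - - t) × Small (u * - t + v * - - t + w * - - t)
  window-small w010 (inj₁ refl) = small₀  , small₁  , small₁
  window-small w010 (inj₂ refl) = small₀  , small₋₁ , small₋₁
  window-small w100 (inj₁ refl) = small₋₁ , small₋₁ , small₋₁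
  window-small w100 (inj₂ refl) = small₁  , small₁  , small₁
  window-small w001 (inj₁ refl) = small₀  , small₀  , small₁
  window-small w001 (inj₂ refl) = small₀  , small₀  , small₋₁

  A-remainder : ∀ q (r : Fin 4) → ∃ λ e → Small e × A (toℕ r ℕ.+ q ℕ.* 4) ≡ A (q ℕ.* 4) + e
  A-remainder q = λ where
      zero                   → 0ℤ , small₀ , sym (ℤ.+-identityʳ a)
      (suc zero)             → x , proj₁ small , eq₁
      (suc (suc zero))       → x + y , proj₁ (proj₂ small) , trans eq₂ (ℤ.+-assoc a x y)
      (suc (suc (suc zero))) → x + y + z , proj₂ (proj₂ small) , trans eq₃ (assoc₄ a x y z)
    where
    a = A (q ℕ.* 4)
    x = term (χ q) (tm q)
    y = term (χ (1 ℕ.+ q)) (- tm q)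
    z = term (χ (2 ℕ.+ q)) (- tm q)
    small : Small x × Small (x + y) × Small (x + y + z)
    small = window-small (χ-window q) (tm±1 q)
    eq₁ : A (1 ℕ.+ q ℕ.* 4) ≡ a + x
    eq₁ = cong (_+_ a) (cong₂ term (χ-4n 0 q) (tm-4n q))
    eq₂ : A (2 ℕ.+ q ℕ.* 4) ≡ a + x + y
    eq₂ = cong₂ _+_ eq₁ (cong₂ term (χ-4n 1 q) (tm-4n+1 q))
    eq₃ : A (3 ℕ.+ q ℕ.* 4) ≡ a + x + y + z
    eq₃ = cong₂ _+_ eq₂ (cong₂ term (χ-4n 2 q) (tm-4n+2 q))
    assoc₄ : ∀ a x y z → a + x + y + z ≡ a + (x + y + z)
    assoc₄ = ℤ-Ring.solve-∀

  -- `∑ tm q` and the remainder add at most 1 each, and -1 is the fixed point of a ↦ 3a + 2.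
  A-step-upper : ∀ q (r : Fin 4) → A (toℕ r ℕ.+ q ℕ.* 4) + 1ℤ ≤ + 3 * (A q + 1ℤ)
  A-step-upper q r with A-remainder q r
  ... | e , (_ , e≤1) , eq = begin
    A (toℕ r ℕ.+ q ℕ.* 4) + 1ℤ        ≡⟨ cong (_+ 1ℤ) (trans eq (cong (_+ e) (A-4n q))) ⟩
    + 3 * A q + ∑ tm q + e + 1ℤ        ≤⟨ ℤ.+-monoˡ-≤ 1ℤ (ℤ.+-mono-≤ (ℤ.+-monoʳ-≤ (+ 3 * A q) (proj₂ (∑tm-small q))) e≤1) ⟩
    + 3 * A q + 1ℤ + 1ℤ + 1ℤ           ≡⟨ ring (A q) ⟩
    + 3 * (A q + 1ℤ)                   ∎
    where
    open ℤ.≤-Reasoning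
    ring : ∀ a → + 3 * a + 1ℤ + 1ℤ + 1ℤ ≡ + 3 * (a + 1ℤ)
    ring = ℤ-Ring.solve-∀

  -- Dually, 1 is the fixed point of a ↦ 3a - 2.
  A-step-lower : ∀ q (r : Fin 4) → + 3 * (A q - 1ℤ) ≤ A (toℕ r ℕ.+ q ℕ.* 4) - 1ℤ
  A-step-lower q r with A-remainder q r
  ... | e , (-1≤e , _) , eq = begin
    + 3 * (A q - 1ℤ)                   ≡⟨ ring (A q) ⟩
    + 3 * A q + -1ℤ + -1ℤ - 1ℤ         ≤⟨ ℤ.+-monoˡ-≤ -1ℤ (ℤ.+-mono-≤ (ℤ.+-monoʳ-≤ (+ 3 * A q) (proj₁ (∑tm-small q))) -1≤e) ⟩
    + 3 * A q + ∑ tm q + e - 1ℤ        ≡⟨ cong (_- 1ℤ) (trans eq (cong (_+ e) (A-4n q))) ⟨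
    A (toℕ r ℕ.+ q ℕ.* 4) - 1ℤ        ∎
    where
    open ℤ.≤-Reasoning
    ring : ∀ a → + 3 * (a - 1ℤ) ≡ + 3 * a + -1ℤ + -1ℤ - 1ℤ
    ring = ℤ-Ring.solve-∀

  -- Growth of `A` compared with powers of 3

  A-upper : ∀ m n → n ℕ.< 4 ^ m → A n + 1ℤ ≤ + 3 ^ m
  A-upper zero zero    _        = ℤ.≤-refl
  A-upper zero (suc n) (s≤s ())
  A-upper (suc m) n n<4^[1+m] with n divMod 4
  ... | result q r refl = begin
    A (toℕ r ℕ.+ q ℕ.* 4) + 1ℤ    ≤⟨ A-step-upper q r ⟩
    + 3 * (A q + 1ℤ)               ≤⟨ ℤ.*-monoˡ-≤-nonNeg (+ 3) (A-upper m q q<4^m) ⟩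
    + 3 * + 3 ^ m                  ≡⟨ ℤ.pos-* 3 (3 ^ m) ⟨
    + 3 ^ suc m                    ∎
    where
    open ℤ.≤-Reasoning
    q<4^m : q ℕ.< 4 ^ m
    q<4^m = ℕ.*-cancelʳ-< 4 q (4 ^ m) (ℕ.≤-<-trans (ℕ.m≤n+m (q ℕ.* 4) (toℕ r))
      (subst (toℕ r ℕ.+ q ℕ.* 4 ℕ.<_) (ℕ.*-comm 4 (4 ^ m)) n<4^[1+m]))

  quotient-≥ : ∀ {k} q (r : Fin 4) → k ℕ.* 4 ℕ.≤ toℕ r ℕ.+ q ℕ.* 4 → k ℕ.≤ q
  quotient-≥ {k} q r h = ℕ.<⇒≤pred (ℕ.*-cancelʳ-< 4 k (suc q)
    (ℕ.≤-<-trans h (ℕ.+-monoˡ-< (q ℕ.* 4) (Fin.toℕ<n r))))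

  -- The lower recursion gains nothing until `A` exceeds its fixed point 1, so growth has to start
  -- from a value of at least 2.
  1≤A-1 : ∀ n → 5 ℕ.≤ n → 1ℤ ≤ A n - 1ℤ
  1≤A-1 = <-rec (λ n → 5 ℕ.≤ n → 1ℤ ≤ A n - 1ℤ) step
    where
    -- The range from 5 to 19 consists of the n ≥ 5 whose quotient by 4 is below 5; from 20 on the
    -- induction hypothesis applies to the quotient.
    initial : ∀ (i : Fin 15) → 1ℤ ≤ A (5 ℕ.+ toℕ i) - 1ℤ
    initial = from-yes (Fin.all? λ (i : Fin 15) → 1ℤ ℤ.≤? A (5 ℕ.+ toℕ i) - 1ℤ)

    step : ∀ n → (∀ {k} → k ℕ.< n → 5 ℕ.≤ k → 1ℤ ≤ A k - 1ℤ) → 5 ℕ.≤ n → 1ℤ ≤ A n - 1ℤ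
    step n rec 5≤n with n ℕ.<? 20
    ... | yes n<20 = subst (λ k → 1ℤ ≤ A k - 1ℤ)
          (trans (cong (5 ℕ.+_) (Fin.toℕ-fromℕ< n-5<15)) (ℕ.m+[n∸m]≡n 5≤n))
          (initial (fromℕ< n-5<15))
      where
      n-5<15 : n ℕ.∸ 5 ℕ.< 15
      n-5<15 = ℕ.∸-monoˡ-< n<20 5≤n
    ... | no n≮20 with n divMod 4
    ...   | result q r refl = ℤ.≤-trans
            (ℤ.≤-trans (from-yes (1ℤ ℤ.≤? + 3)) (ℤ.*-monoˡ-≤-nonNeg (+ 3) (rec q<n 5≤q)))
            (A-step-lower q r)
      where
      5≤q : 5 ℕ.≤ q
      5≤q = quotient-≥ q r (ℕ.≮⇒≥ n≮20)
      q<n : q ℕ.< toℕ r ℕ.+ q ℕ.* 4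
      q<n = ℕ.<-≤-trans (ℕ.m<m*n q 4 {{ℕ.>-nonZero (ℕ.<-≤-trans ℕ.z<s 5≤q)}} (s≤s (s≤s z≤n)))
        (ℕ.m≤n+m (q ℕ.* 4) (toℕ r))

  -- The threshold 5 of `1≤A-1` is multiplied by 4 for each base-4 digit that the induction removes.
  A-lower : ∀ m n → 5 ℕ.* 4 ^ m ℕ.≤ n → + 3 ^ m ≤ A n - 1ℤ
  A-lower zero    n h = 1≤A-1 n h
  A-lower (suc m) n h with n divMod 4
  ... | result q r refl = begin
    + 3 ^ suc m                    ≡⟨ ℤ.pos-* 3 (3 ^ m) ⟩
    + 3 * + 3 ^ m                  ≤⟨ ℤ.*-monoˡ-≤-nonNeg (+ 3) (A-lower m q 5*4^m≤q) ⟩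
    + 3 * (A q - 1ℤ)               ≤⟨ A-step-lower q r ⟩
    A (toℕ r ℕ.+ q ℕ.* 4) - 1ℤ    ∎
    where
    open ℤ.≤-Reasoning
    5*4^m≤q : 5 ℕ.* 4 ^ m ℕ.≤ q
    5*4^m≤q = quotient-≥ q r (subst (ℕ._≤ toℕ r ℕ.+ q ℕ.* 4)
      (trans (cong (5 ℕ.*_) (ℕ.*-comm 4 (4 ^ m))) (sym (ℕ.*-assoc 5 (4 ^ m) 4))) h)

  -- From the counts to `A`

  module _ {P : ℕ → Set} (P? : Decidable P) where

    count-suc : ∀ n → count P? (suc n) ≡ count P? n ℕ.+ length (filter P? (n ∷ []))
    count-suc n = begin
      length (filter P? (upTo (suc n)))                      ≡⟨ cong (λ xs → length (filter P? xs)) (upTo-∷ʳ n) ⟨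
      length (filter P? (upTo n ++ n ∷ []))                  ≡⟨ cong length (filter-++ P? (upTo n) (n ∷ [])) ⟩
      length (filter P? (upTo n) ++ filter P? (n ∷ []))      ≡⟨ length-++ (filter P? (upTo n)) ⟩
      count P? n ℕ.+ length (filter P? (n ∷ []))             ∎
      where open ≡-Reasoning

    count-accept : ∀ n → P n → count P? (suc n) ≡ count P? n ℕ.+ 1
    count-accept n p = trans (count-suc n) (cong (λ xs → count P? n ℕ.+ length xs) (filter-accept P? p))

    count-reject : ∀ n → ¬ P n → count P? (suc n) ≡ count P? n
    count-reject n ¬p = trans (count-suc n)
      (trans (cong (λ xs → count P? n ℕ.+ length xs) (filter-reject P? ¬p)) (ℕ.+-identityʳ _))

  OddEvil₃ OddOdious₃ : ℕ → Set
  OddEvil₃   k = Odd k × Evil k × 3 ∣ k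
  OddOdious₃ k = Odd k × Odious k × 3 ∣ k

  oddEvil₃? : Decidable OddEvil₃
  oddEvil₃? k = odd? k ×-dec evil? k ×-dec (3 ∣? k)

  oddOdious₃? : Decidable OddOdious₃
  oddOdious₃? k = odd? k ×-dec odious? k ×-dec (3 ∣? k)

  Δ-reject : ∀ n → ¬ (Odd n × 3 ∣ n) → Δ₃ᵒᵈᵈ (suc n) ≡ Δ₃ᵒᵈᵈ n
  Δ-reject n ¬p = cong₂ (λ a b → + a - + b)
    (count-reject oddEvil₃? n (λ (o , _ , d) → ¬p (o , d)))
    (count-reject oddOdious₃? n (λ (o , _ , d) → ¬p (o , d)))

  -- Being evil or odious selects the count that `n` enters, and `tm n` is the sign of that count in
  -- the difference.
  Δ-accept : ∀ n → Odd n → 3 ∣ n → Δ₃ᵒᵈᵈ (suc n) ≡ Δ₃ᵒᵈᵈ n + tm n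
  Δ-accept n odd 3∣n = by-parity (evil? n)
    where
    open ≡-Reasoning
    ring₊ : ∀ a b → a + 1ℤ - b ≡ a - b + 1ℤ
    ring₊ = ℤ-Ring.solve-∀
    ring₋ : ∀ a b → a - (b + 1ℤ) ≡ a - b + -1ℤ
    ring₋ = ℤ-Ring.solve-∀

    by-parity : Dec (Evil n) → Δ₃ᵒᵈᵈ (suc n) ≡ Δ₃ᵒᵈᵈ n + tm n
    by-parity (yes evil) = begin
      Δ₃ᵒᵈᵈ (suc n)
        ≡⟨ cong₂ (λ a b → + a - + b)
             (count-accept oddEvil₃? n (odd , evil , 3∣n))
             (count-reject oddOdious₃? n (λ (_ , o , _) → o evil)) ⟩
      + count oddEvil₃? n + 1ℤ - + count oddOdious₃? n
        ≡⟨ ring₊ (+ count oddEvil₃? n) (+ count oddOdious₃? n) ⟩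
      + count oddEvil₃? n - + count oddOdious₃? n + 1ℤ
        ≡⟨ cong (_+_ (Δ₃ᵒᵈᵈ n)) (sign-even evil) ⟨
      Δ₃ᵒᵈᵈ n + tm n ∎
    by-parity (no odious) = begin
      Δ₃ᵒᵈᵈ (suc n)
        ≡⟨ cong₂ (λ a b → + a - + b)
             (count-reject oddEvil₃? n (λ (_ , e , _) → odious e))
             (count-accept oddOdious₃? n (odd , odious , 3∣n)) ⟩
      + count oddEvil₃? n - (+ count oddOdious₃? n + 1ℤ)
        ≡⟨ ring₋ (+ count oddEvil₃? n) (+ count oddOdious₃? n) ⟩
      + count oddEvil₃? n - + count oddOdious₃? n + -1ℤ
        ≡⟨ cong (_+_ (Δ₃ᵒᵈᵈ n)) (sign-odd odious) ⟨
      Δ₃ᵒᵈᵈ n + tm n ∎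

  odd-1+n*2 : ∀ n → Odd (1 ℕ.+ n ℕ.* 2)
  odd-1+n*2 n (divides k eq) = m*2≢1+n*2 k n (sym eq)

  -- Going from 2q to 2q + 2 adds the even number 2q, which is rejected, and 2q + 1, which accounts
  -- for the term of `A` at q. The signature stands ahead of `Δ-odd` because the two are mutually
  -- recursive.
  Δ-even : ∀ q → Δ₃ᵒᵈᵈ (q ℕ.* 2) ≡ A q

  Δ-odd : ∀ q → Δ₃ᵒᵈᵈ (1 ℕ.+ q ℕ.* 2) ≡ A q
  Δ-odd q = trans (Δ-reject (q ℕ.* 2) (λ (odd , _) → odd (divides q refl))) (Δ-even q)

  Δ-even zero = refl
  Δ-even (suc q) with χ-divides q
  ... | inj₁ (3∣ , χ≡1) = begin
    Δ₃ᵒᵈᵈ (2 ℕ.+ q ℕ.* 2)                        ≡⟨ Δ-accept (1 ℕ.+ q ℕ.* 2) (odd-1+n*2 q) 3∣ ⟩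
    Δ₃ᵒᵈᵈ (1 ℕ.+ q ℕ.* 2) + tm (1 ℕ.+ q ℕ.* 2)   ≡⟨ cong₂ _+_ (Δ-odd q) (tm-odd q) ⟩
    A q + - tm q                                 ≡⟨ cong (_+_ (A q)) (ℤ.*-identityˡ (- tm q)) ⟨
    A q + term 1ℤ (tm q)                         ≡⟨ cong (λ u → A q + term u (tm q)) χ≡1 ⟨
    A (suc q)                                    ∎
    where open ≡-Reasoning
  ... | inj₂ (3∤ , χ≡0) = begin
    Δ₃ᵒᵈᵈ (2 ℕ.+ q ℕ.* 2)                        ≡⟨ Δ-reject (1 ℕ.+ q ℕ.* 2) (λ (_ , 3∣) → 3∤ 3∣) ⟩
    Δ₃ᵒᵈᵈ (1 ℕ.+ q ℕ.* 2)                        ≡⟨ Δ-odd q ⟩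
    A q                                          ≡⟨ ℤ.+-identityʳ (A q) ⟨
    A q + term 0ℤ (tm q)                         ≡⟨ cong (λ u → A q + term u (tm q)) χ≡0 ⟨
    A (suc q)                                    ∎
    where open ≡-Reasoning

  Δ≡A : ∀ q (r : Fin 2) → Δ₃ᵒᵈᵈ (toℕ r ℕ.+ q ℕ.* 2) ≡ A q
  Δ≡A q zero       = Δ-even q
  Δ≡A q (suc zero) = Δ-odd q

  i≤i+1 : ∀ i → i ≤ i + 1ℤ
  i≤i+1 i = subst (_≤ i + 1ℤ) (ℤ.+-identityʳ i) (ℤ.+-monoʳ-≤ i (from-yes (0ℤ ℤ.≤? 1ℤ)))

  Δ-upper : ∀ m n → n ℕ.< 4 ^ m → Δ₃ᵒᵈᵈ n ≤ + 3 ^ m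
  Δ-upper m n n<4^m with n divMod 2
  ... | result q r refl = subst (_≤ + 3 ^ m) (sym (Δ≡A q r))
    (ℤ.≤-trans (i≤i+1 (A q)) (A-upper m q (ℕ.≤-<-trans q≤n n<4^m)))
    where
    q≤n : q ℕ.≤ toℕ r ℕ.+ q ℕ.* 2
    q≤n = ℕ.≤-trans (ℕ.m≤m*n q 2) (ℕ.m≤n+m (q ℕ.* 2) (toℕ r))

  -- Halving n and the threshold 5 together cost a factor 10, which two powers of 4 cover; the spare
  -- 16 - 10 = 6 appears in `ring`.
  Δ-lower : ∀ m n → 4 ^ (2 ℕ.+ m) ℕ.≤ n → + 3 ^ m ≤ Δ₃ᵒᵈᵈ n
  Δ-lower m n h with n divMod 2
  ... | result q r refl = subst (+ 3 ^ m ≤_) (sym (Δ≡A q r))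
    (ℤ.≤-trans (A-lower m q 5*4^m≤q) (ℤ.i≤j⇒i-k≤j 1ℤ ℤ.≤-refl))
    where
    open ℕ.≤-Reasoning
    ring : ∀ x → 5 ℕ.* x ℕ.* 2 ℕ.+ 6 ℕ.* x ≡ 4 ℕ.* (4 ℕ.* x)
    ring = ℕ-Ring.solve-∀
    5*4^m≤q : 5 ℕ.* 4 ^ m ℕ.≤ q
    5*4^m≤q = ℕ.<⇒≤pred (ℕ.*-cancelʳ-< 2 (5 ℕ.* 4 ^ m) (suc q) (begin-strict
      5 ℕ.* 4 ^ m ℕ.* 2                    ≤⟨ ℕ.m≤m+n _ (6 ℕ.* 4 ^ m) ⟩
      5 ℕ.* 4 ^ m ℕ.* 2 ℕ.+ 6 ℕ.* 4 ^ m    ≡⟨ ring (4 ^ m) ⟩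
      4 ^ (2 ℕ.+ m)                        ≤⟨ h ⟩
      toℕ r ℕ.+ q ℕ.* 2                    <⟨ ℕ.+-monoˡ-< (q ℕ.* 2) (Fin.toℕ<n r) ⟩
      suc q ℕ.* 2                          ∎))

-- Approximate logarithm laws for Riemann sums

module RiemannSums where

  open import Data.Rational.Base using (ℚ; 0ℚ; 1ℚ; ½; _+_; _-_; _*_; _/_; _≤_; ∣_∣; ↧ₙ_; positive; nonNegative)
  open import Data.Rational.Properties
  open import Data.Rational.Solver using (module +-*-Solver)

  ι : ℕ → ℚ
  ι n = + n / 1

  ι-suc : ∀ n → ι (suc n) ≡ ι n + 1ℚ
  ι-suc n = /-+-suc n 0

  0≤ι : ∀ n → 0ℚ ≤ ι n
  0≤ι n = nonNegative⁻¹ (ι n) {{normalize-nonNeg n 1}}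

  /≡ι* : ∀ l d → + l / suc d ≡ ι l * (+ 1 / suc d)
  /≡ι* zero d = trans (0/n≡0 (suc d)) (sym (*-zeroˡ (+ 1 / suc d)))
  /≡ι* (suc l) d = begin
    + suc l / suc d                                ≡⟨ /-+-suc l d ⟩
    + l / suc d + δ                                ≡⟨ cong (_+ δ) (/≡ι* l d) ⟩
    ι l * δ + δ                                    ≡⟨ solve 2 (λ a δ → a :* δ :+ δ := (a :+ con 1ℚ) :* δ) refl (ι l) δ ⟩
    (ι l + 1ℚ) * δ                                 ≡⟨ cong (_* δ) (ι-suc l) ⟨
    ι (suc l) * δ                                  ∎
    where
    open ≡-Reasoning
    open +-*-Solver
    δ = + 1 / suc d

  riemannSum-mono : ∀ {a b} m → a ℕ.≤ b → riemannSum a m ≤ riemannSum b m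
  riemannSum-mono {a} {b} m a≤b = subst (λ k → riemannSum a m ≤ harmonic (suc m) k)
    (ℕ.m+[n∸m]≡n (ℕ.*-monoˡ-≤ (suc m) (ℕ.∸-monoˡ-≤ 1 a≤b)))
    (harmonic-≤-+ (suc m) ((a ℕ.∸ 1) ℕ.* suc m) _)

  -- Substitution in the integral: with M = m+1, the interval [α,αβ] with mesh 1/M
  -- is α times [1,β] with mesh 1/(αM), where α = a+1, β = b+1 and αM = (m+aM)+1.
  riemannSum-* : ∀ a b m →
    riemannSum (suc a ℕ.* suc b) m ≡ riemannSum (suc a) m + riemannSum (suc b) (m ℕ.+ a ℕ.* suc m)
  riemannSum-* a b m = trans
    (cong (harmonic (suc m)) (split a b (suc m)))
    (harmonic-+ (suc m) (a ℕ.* suc m) (b ℕ.* (suc a ℕ.* suc m)))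
    where
    split : ∀ a b M → (b ℕ.+ a ℕ.* suc b) ℕ.* M ≡ a ℕ.* M ℕ.+ b ℕ.* (suc a ℕ.* M)
    split = ℕ-Ring.solve-∀

  -- In `riemannSum-*` the second factor is summed with a finer mesh. Right-endpoint sums of the
  -- decreasing 1/t only grow under such a refinement, by `refine-lower`.
  riemannSum-*-lower : ∀ a b m → riemannSum (suc a) m + riemannSum (suc b) m ≤ riemannSum (suc a ℕ.* suc b) m
  riemannSum-*-lower a b m = ≤-trans
    (+-monoʳ-≤ (riemannSum (suc a) m)
      (subst (riemannSum (suc b) m ≤_)
        (cong₂ harmonic (ℕ.*-comm (suc m) (suc a))
          (trans (ℕ.*-assoc b (suc m) (suc a)) (cong (b ℕ.*_) (ℕ.*-comm (suc m) (suc a)))))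
        (refine-lower (suc m) (b ℕ.* suc m) a)))
    (≤-reflexive (sym (riemannSum-* a b m)))

  -- Returning to the mesh 1/M costs at most one mesh width, by `riemannSum-≤`.
  riemannSum-*-upper : ∀ a b m → riemannSum (suc a ℕ.* suc b) m ≤
    riemannSum (suc a) m + (+ 1 / suc m + riemannSum (suc b) m)
  riemannSum-*-upper a b m = ≤-trans (≤-reflexive (riemannSum-* a b m))
    (+-monoʳ-≤ (riemannSum (suc a) m) (riemannSum-≤ (suc b) (m ℕ.+ a ℕ.* suc m) m))

  riemannSum-^-lower : ∀ a k m → ι k * riemannSum (suc a) m ≤ riemannSum (suc a ^ k) m
  riemannSum-^-lower a zero m = ≤-reflexive (*-zeroˡ (riemannSum (suc a) m))
  riemannSum-^-lower a (suc k) m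
    -- The product estimates take successors as factors: the power is abstracted, and `m^n≢0`
    -- excludes zero.
    with suc a ^ k | ℕ.m^n≢0 (suc a) k | riemannSum-^-lower a k m
  ... | suc b | _ | ih = begin
    ι (suc k) * x              ≡⟨ cong (_* x) (ι-suc k) ⟩
    (ι k + 1ℚ) * x             ≡⟨ solve 2 (λ n x → (n :+ con 1ℚ) :* x := x :+ n :* x) refl (ι k) x ⟩
    x + ι k * x                ≤⟨ +-monoʳ-≤ x ih ⟩
    x + riemannSum (suc b) m   ≤⟨ riemannSum-*-lower a b m ⟩
    riemannSum (suc a ℕ.* suc b) m ∎
    where
    open ≤-Reasoning
    open +-*-Solver
    x = riemannSum (suc a) m

  -- Each factor costs at most one mesh width δ, hence k of them in total.
  riemannSum-^-upper : ∀ a k m → riemannSum (suc a ^ k) m ≤ ι k * (riemannSum (suc a) m + + 1 / suc m)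
  riemannSum-^-upper a zero m = ≤-reflexive (sym (*-zeroˡ (riemannSum (suc a) m + + 1 / suc m)))
  riemannSum-^-upper a (suc k) m
    with suc a ^ k | ℕ.m^n≢0 (suc a) k | riemannSum-^-upper a k m
  ... | suc b | _ | ih = begin
    riemannSum (suc a ℕ.* suc b) m      ≤⟨ riemannSum-*-upper a b m ⟩
    x + (δ + riemannSum (suc b) m)      ≤⟨ +-monoʳ-≤ x (+-monoʳ-≤ δ ih) ⟩
    x + (δ + ι k * (x + δ))             ≡⟨ solve 3 (λ n x δ → x :+ (δ :+ n :* (x :+ δ)) := (n :+ con 1ℚ) :* (x :+ δ)) refl (ι k) x δ ⟩
    (ι k + 1ℚ) * (x + δ)                ≡⟨ cong (_* (x + δ)) (ι-suc k) ⟨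
    ι (suc k) * (x + δ)                 ∎
    where
    open ≤-Reasoning
    open +-*-Solver
    x = riemannSum (suc a) m
    δ = + 1 / suc m

  -- Estimating the quotient of logarithms

  p≤p+q : ∀ p {q} → 0ℚ ≤ q → p ≤ p + q
  p≤p+q p {q} 0≤q = subst (_≤ p + q) (+-identityʳ p) (+-monoʳ-≤ p 0≤q)

  0<⇒≢0 : ∀ {p} → 0ℚ ℚ.< p → p ≢ 0ℚ
  0<⇒≢0 0<p p≡0 = <⇒≢ 0<p (sym p≡0)

  -- Here κ = m-2, x ≈ ln 3, y ≈ ln 4, D ≈ ln Δ and E ≈ ln n with 4^m ≤ n < 4^(m+1);
  -- clearing denominators, ∣Dy - xE∣ ≤ 4y² while Ey ≥ my².
  quotient-close : ∀ {D E x y δ κ η} → 0ℚ ≤ κ → 0ℚ ≤ x → x ≤ y → ½ ≤ y →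
    (κ + 1ℚ + 1ℚ + 1ℚ) * δ ≤ ½ →
    κ * x ≤ D → D ≤ (κ + 1ℚ + 1ℚ + 1ℚ) * (x + δ) →
    (κ + 1ℚ + 1ℚ) * y ≤ E → E ≤ (κ + 1ℚ + 1ℚ + 1ℚ) * (y + δ) →
    ι 4 ≤ η * (κ + 1ℚ + 1ℚ) →
    ∣ D * recip E - x * recip y ∣ ≤ η
  quotient-close {D} {E} {x} {y} {δ} {κ} {η} 0≤κ 0≤x x≤y ½≤y νδ≤½ D≥ D≤ E≥ E≤ 4≤ =
    *-cancelʳ-≤-pos (ν * (y * y)) {{positive (0<p*q 0<ν 0<yy)}} (begin
      q * (ν * (y * y))            ≡⟨ solve 3 (λ q ν y → q :* (ν :* (y :* y)) := q :* ((ν :* y) :* y)) refl q ν y ⟩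
      -- Trading `ν * y` for the larger `E` lets both fractions be cleared.
      q * ((ν * y) * y)            ≤⟨ *-monoˡ-≤-nonNeg q {{∣-∣-nonNeg d}} (*-monoʳ-≤-nonNeg y {{nonNegative 0≤y}} E≥) ⟩
      q * (E * y)                  ≡⟨ clear ⟩
      ∣ D * y - x * E ∣            ≤⟨ ∣p-q∣≤r Dy≤ xE≤ ⟩
      ι 4 * (y * y)                ≤⟨ *-monoʳ-≤-nonNeg (y * y) {{nonNegative (<⇒≤ 0<yy)}} 4≤ ⟩
      η * ν * (y * y)              ≡⟨ *-assoc η ν (y * y) ⟩
      η * (ν * (y * y))            ∎)
    where
    open +-*-Solver
    open ≤-Reasoning
    ν = κ + 1ℚ + 1ℚ
    d = D * recip E - x * recip y
    q = ∣ d ∣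
    0<y : 0ℚ ℚ.< y
    0<y = <-≤-trans (positive⁻¹ ½) ½≤y
    0≤y : 0ℚ ≤ y
    0≤y = <⇒≤ 0<y
    0<yy : 0ℚ ℚ.< y * y
    0<yy = 0<p*q 0<y 0<y
    0<ν : 0ℚ ℚ.< ν
    0<ν = +-mono-≤-< {0ℚ} {κ + 1ℚ} (+-mono-≤ {0ℚ} {κ} 0≤κ (nonNegative⁻¹ 1ℚ)) (positive⁻¹ 1ℚ)
    0<E : 0ℚ ℚ.< E
    0<E = <-≤-trans (0<p*q 0<ν 0<y) E≥

    clear : q * (E * y) ≡ ∣ D * y - x * E ∣
    clear = begin-equality
      q * (E * y)                   ≡⟨ cong (q *_) (0≤p⇒∣p∣≡p (<⇒≤ (0<p*q 0<E 0<y))) ⟨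
      q * ∣ E * y ∣                 ≡⟨ ∣p*q∣≡∣p∣*∣q∣ d (E * y) ⟨
      ∣ d * (E * y) ∣               ≡⟨ cong ∣_∣ (solve 6 (λ D E x y s t →
        (D :* s :- x :* t) :* (E :* y) := D :* y :* (E :* s) :- x :* E :* (y :* t)) refl
        D E x y (recip E) (recip y)) ⟩
      ∣ D * y * (E * recip E) - x * E * (y * recip y) ∣
        ≡⟨ cong₂ (λ s t → ∣ D * y * s - x * E * t ∣) (p*recip[p]≡1 E (0<⇒≢0 0<E)) (p*recip[p]≡1 y (0<⇒≢0 0<y)) ⟩
      ∣ D * y * 1ℚ - x * E * 1ℚ ∣   ≡⟨ cong₂ (λ s t → ∣ s - t ∣) (*-identityʳ (D * y)) (*-identityʳ (x * E)) ⟩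
      ∣ D * y - x * E ∣             ∎

    xy≤yy : x * y ≤ y * y
    xy≤yy = *-monoʳ-≤-nonNeg y {{nonNegative 0≤y}} x≤y

    -- The accumulated mesh errors of a power estimate amount to at most one `y`.
    slack : (ν + 1ℚ) * δ ≤ y
    slack = ≤-trans νδ≤½ ½≤y

    Dy≤ : D * y ≤ ι 4 * (y * y) + x * E
    Dy≤ = begin
      D * y
        ≤⟨ *-monoʳ-≤-nonNeg y {{nonNegative 0≤y}} D≤ ⟩
      (ν + 1ℚ) * (x + δ) * y
        ≡⟨ solve 4 (λ ν x y δ → (ν :+ con 1ℚ) :* (x :+ δ) :* y :=
             x :* y :+ (ν :+ con 1ℚ) :* δ :* y :+ x :* (ν :* y)) refl ν x y δ ⟩
      x * y + (ν + 1ℚ) * δ * y + x * (ν * y)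
        ≤⟨ +-mono-≤ (+-mono-≤ xy≤yy (*-monoʳ-≤-nonNeg y {{nonNegative 0≤y}} slack))
             (*-monoˡ-≤-nonNeg x {{nonNegative 0≤x}} E≥) ⟩
      y * y + y * y + x * E
        -- Two copies of y² suffice on this side; two more are added to match the 4y² of `xE≤`.
        ≤⟨ +-monoˡ-≤ (x * E) (p≤p+q (y * y + y * y) (+-mono-≤ (<⇒≤ 0<yy) (<⇒≤ 0<yy))) ⟩
      y * y + y * y + (y * y + y * y) + x * E
        ≡⟨ solve 2 (λ s t → s :+ s :+ (s :+ s) :+ t := con (ι 4) :* s :+ t) refl (y * y) (x * E) ⟩
      ι 4 * (y * y) + x * E ∎

    xE≤ : x * E ≤ ι 4 * (y * y) + D * y
    xE≤ = begin
      x * E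
        ≤⟨ *-monoˡ-≤-nonNeg x {{nonNegative 0≤x}} E≤ ⟩
      x * ((ν + 1ℚ) * (y + δ))
        -- Here `ν + 1ℚ` is κ + 3: the part κ is absorbed into `D` through `D≥`, the 3 leaves three
        -- copies of xy, and the mesh error makes the fourth copy of y².
        ≡⟨ solve 4 (λ κ x y δ → x :* ((κ :+ con 1ℚ :+ con 1ℚ :+ con 1ℚ) :* (y :+ δ)) :=
             con (ι 3) :* (x :* y) :+ x :* ((κ :+ con 1ℚ :+ con 1ℚ :+ con 1ℚ) :* δ) :+ κ :* x :* y) refl κ x y δ ⟩
      ι 3 * (x * y) + x * ((ν + 1ℚ) * δ) + κ * x * y
        ≤⟨ +-mono-≤ (+-mono-≤ (*-monoˡ-≤-nonNeg (ι 3) xy≤yy)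
             (≤-trans (*-monoˡ-≤-nonNeg x {{nonNegative 0≤x}} slack) xy≤yy))
             (*-monoʳ-≤-nonNeg y {{nonNegative 0≤y}} D≥) ⟩
      ι 3 * (y * y) + y * y + D * y
        ≡⟨ solve 2 (λ s t → con (ι 3) :* s :+ s :+ t := con (ι 4) :* s :+ t) refl (y * y) (D * y) ⟩
      ι 4 * (y * y) + D * y ∎

  -- The condition on `i` makes k + 3 mesh widths at most ½. Monotonicity and the power estimates
  -- turn the bounds by powers of 3 and 4 into the hypotheses of `quotient-close`.
  ln-ratio-close : ∀ {d n k i η} →
    3 ^ k ℕ.≤ d → d ℕ.≤ 3 ^ (3 ℕ.+ k) → 4 ^ (2 ℕ.+ k) ℕ.≤ n → n ℕ.≤ 4 ^ (3 ℕ.+ k) →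
    (3 ℕ.+ k) ℕ.* 2 ℕ.≤ suc i → ι 4 ≤ η * ι (2 ℕ.+ k) →
    ∣ riemannSum d i * recip (riemannSum n i) - riemannSum 3 i * recip (riemannSum 4 i) ∣ ≤ η
  ln-ratio-close {d} {n} {k} {i} {η} d≥ d≤ n≥ n≤ i≥ 4≤ = quotient-close
    (0≤ι k) (≤-trans (nonNegative⁻¹ ½) (½≤riemannSum 1 i)) (riemannSum-mono {3} {4} i (ℕ.n≤1+n 3)) (½≤riemannSum 2 i)
    (subst (λ ν → ν * (+ 1 / suc i) ≤ ½) ι3+k (subst (_≤ ½) (/≡ι* (3 ℕ.+ k) i)
      (/-mono-≤ {3 ℕ.+ k} {i} {1} {1} (subst ((3 ℕ.+ k) ℕ.* 2 ℕ.≤_) (sym (ℕ.*-identityˡ (suc i))) i≥))))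
    (≤-trans (riemannSum-^-lower 2 k i) (riemannSum-mono i d≥))
    (subst (λ ν → riemannSum d i ≤ ν * (riemannSum 3 i + + 1 / suc i)) ι3+k
      (≤-trans (riemannSum-mono i d≤) (riemannSum-^-upper 2 (3 ℕ.+ k) i)))
    (subst (λ ν → ν * riemannSum 4 i ≤ riemannSum n i) ι2+k
      (≤-trans (riemannSum-^-lower 3 (2 ℕ.+ k) i) (riemannSum-mono i n≥)))
    (subst (λ ν → riemannSum n i ≤ ν * (riemannSum 4 i + + 1 / suc i)) ι3+k
      (≤-trans (riemannSum-mono i n≤) (riemannSum-^-upper 3 (3 ℕ.+ k) i)))
    (subst (λ ν → ι 4 ≤ η * ν) ι2+k 4≤)
    where
    ι2+k : ι (2 ℕ.+ k) ≡ ι k + 1ℚ + 1ℚ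
    ι2+k = trans (ι-suc (suc k)) (cong (_+ 1ℚ) (ι-suc k))
    ι3+k : ι (3 ℕ.+ k) ≡ ι k + 1ℚ + 1ℚ + 1ℚ
    ι3+k = trans (ι-suc (2 ℕ.+ k)) (cong (_+ 1ℚ) ι2+k)

  -- A positive η is at least 1 over its denominator, hence exceeds 1/(1 + `↧ₙ η`).
  archimedean : ∀ η m → 0ℚ ℚ.< η → 4 ℕ.* suc (↧ₙ η) ℕ.≤ m → ι 4 ≤ η * ι m
  archimedean η m 0<η h = begin
    ι 4                        ≤⟨ /-mono-≤ {4} {0} {m} {↧ₙ η} (subst (4 ℕ.* suc (↧ₙ η) ℕ.≤_) (sym (ℕ.*-identityʳ m)) h) ⟩
    + m / suc (↧ₙ η)           ≡⟨ /≡ι* m (↧ₙ η) ⟩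
    ι m * (+ 1 / suc (↧ₙ η))   ≤⟨ *-monoˡ-≤-nonNeg (ι m) {{nonNegative (0≤ι m)}} (<⇒≤ (1/[1+↧ε]<ε η 0<η)) ⟩
    ι m * η                    ≡⟨ *-comm (ι m) η ⟩
    η * ι m                    ∎
    where open ≤-Reasoning

-- Passage to the limit

open ThueMorse using (Δ-lower; Δ-upper)
open RiemannSums using (ln-ratio-close; archimedean)

-- For use with `ln`, which evaluates Riemann sums at the absolute value of its argument.
∣∣-bounds : ∀ {a b z} → + a ℤ.≤ z → z ℤ.≤ + b → a ℕ.≤ ℤ.∣ z ∣ × ℤ.∣ z ∣ ℕ.≤ b
∣∣-bounds (ℤ.+≤+ a≤z) (ℤ.+≤+ z≤b) = a≤z , z≤b

⌊log₄⌋ : ∀ n → ∃ λ m → 4 ^ m ℕ.≤ suc n × suc n ℕ.< 4 ^ suc m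
⌊log₄⌋ zero = 0 , ℕ.≤-refl , s≤s (s≤s z≤n)
⌊log₄⌋ (suc n) with ⌊log₄⌋ n
... | m , l , u with suc (suc n) ℕ.<? 4 ^ suc m
...   | yes u′ = m , ℕ.m≤n⇒m≤1+n l , u′
-- Unfolded, `u` already says n + 2 ≤ 4^(m+1), and this is strictly below the next power.
...   | no ¬u = suc m , ℕ.≮⇒≥ ¬u ,
        ℕ.≤-<-trans u (ℕ.^-monoʳ-< 4 (s≤s (s≤s z≤n)) (ℕ.n<1+n (suc m)))

^-cancelʳ-< : ∀ a .{{_ : ℕ.NonZero a}} {m n} → a ^ m ℕ.< a ^ n → m ℕ.< n
^-cancelʳ-< a h = ℕ.≰⇒> λ n≤m → ℕ.<⇒≱ h (ℕ.^-monoʳ-≤ a n≤m)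

theorem4 : HasLimit
    (λ n → (1ℤ < + n) × (0ℤ < Δ₃ᵒᵈᵈ n))
    (λ n (1<n , 0<Δ) → ln (Δ₃ᵒᵈᵈ n) 0<Δ /ᴿ ln (+ n) (1<z⇒0<z 1<n) [ ln#0 1<n ])
    (ln (+ 3) 0<3 /ᴿ ln (+ 4) (1<z⇒0<z 1<4) [ ln#0 1<4 ])
theorem4 ε 0<ε = 4 ^ K , eventually
  where
  -- One half of ε bounds the distance, the other is the gap that `_<ᴿ_` demands.
  η = ℚ.½ ℚ.* ε
  -- For an exponent m ≥ K, `archimedean` gives 4 ≤ ηm. Also K ≥ 4, which rules out m = 0 and m = 1
  -- below.
  K = 4 ℕ.* suc (ℚ.↧ₙ η)
  K≤m : ∀ m {n} → 4 ^ K ℕ.≤ n → n ℕ.< 4 ^ suc m → K ℕ.≤ m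
  K≤m m 4^K≤n n<4^[1+m] = ℕ.s≤s⁻¹ (^-cancelʳ-< 4 {K} {suc m} (ℕ.≤-<-trans 4^K≤n n<4^[1+m]))
  eventually : ∀ n → 4 ^ K ℕ.≤ n → _
  eventually zero 4^K≤0 = contradiction 4^K≤0 (ℕ.<⇒≱ (ℕ.m^n>0 4 K))
  eventually n@(suc n-1) 4^K≤n with ⌊log₄⌋ n-1
  ... | zero     , _ , n<4^[1+m] = contradiction (K≤m 0 4^K≤n n<4^[1+m]) λ ()
  ... | suc zero , _ , n<4^[1+m] = contradiction (K≤m 1 4^K≤n n<4^[1+m]) λ { (s≤s ()) }
  ... | suc (suc k) , 4^m≤n , n<4^[1+m] =
    -- The index from which the mesh is fine enough may grow with n, since `_<ᴿ_` is claimed for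
    -- each n separately.
    (1<n , 0<Δ) , η , 0<½ε 0<ε , (3 ℕ.+ k) ℕ.* 2 , close
    where
    1<n : 1ℤ < + n
    1<n = ℤ.+<+ (ℕ.<-≤-trans (ℕ.^-monoʳ-< 4 (s≤s (s≤s z≤n)) {0} {2 ℕ.+ k} ℕ.z<s) 4^m≤n)
    Δ≥ : + 3 ^ k ℤ.≤ Δ₃ᵒᵈᵈ n
    Δ≥ = Δ-lower k n 4^m≤n
    0<Δ : 0ℤ < Δ₃ᵒᵈᵈ n
    0<Δ = ℤ.<-≤-trans (ℤ.+<+ (ℕ.m^n>0 3 k)) Δ≥
    close : ∀ i → (3 ℕ.+ k) ℕ.* 2 ℕ.≤ i →
      ℚ.∣ riemannSum ℤ.∣ Δ₃ᵒᵈᵈ n ∣ i ℚ.* recip (riemannSum n i)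
          ℚ.- riemannSum 3 i ℚ.* recip (riemannSum 4 i) ∣ ℚ.+ η ℚ.≤ ε
    close i i≥ with ∣∣-bounds Δ≥ (Δ-upper (3 ℕ.+ k) n n<4^[1+m])
    ... | d≥ , d≤ = ℚ.≤-trans
      (ℚ.+-monoˡ-≤ η (ln-ratio-close {k = k} {i} {η} d≥ d≤ 4^m≤n (ℕ.<⇒≤ n<4^[1+m])
        (ℕ.m≤n⇒m≤1+n i≥) (archimedean η (2 ℕ.+ k) (0<½ε 0<ε) (K≤m (2 ℕ.+ k) 4^K≤n n<4^[1+m]))))
      (ℚ.≤-reflexive (½ε+½ε≡ε ε))
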